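{- Fix $t\in\mathbb{C}$. The Boltzmann weights (Gamma-Gamma ice) $$a_1(i,j)=tz_i+z_j,\quad a_2(i,j)=tz_j+z_i,\quad b_1(i,j)=t(z_j-z_i),\quad b_2(i,j)=z_i-z_j,\quad c_1(i,j)=(t+1)z_i,\quad c_2(i,j)=(t+1)z_j$$ satisfy the Yang–Baxter equation: for all labels $i,j,k$, all $z_i,z_j,z_k\in\mathbb{C}$ and every orientation $\sigma$ of the six external edges, $Z_A(\sigma)=Z_B(\sigma)$.
   Context: Six-vertex conventions. Lines are drawn in the plane; each line carries a label $\ell$ with a spectral parameter $z_\ell\in\mathbb{C}$. Every edge is oriented either "left" or "right". A vertex is a transversal crossing of an ascending line (lower left to upper right) with label $p$ and a descending line (upper left to lower right) with label $q$; its edges are BL, TR on the ascending line and TL, BR on the descending line. Admissible types: $a_1$: all four edges point left; $a_2$: all point right; $b_1$: BL, TR left and TL, BR right; $b_2$: BL, TR right and TL, BR left; $c_1$: TL, TR left and BL, BR right; $c_2$: TL, TR right and BL, BR left. A vertex of type $x$ has weight $x(p,q)$; other configurations have weight $0$. Networks. For labels $i,j,k$: external edges $L_k,L_j,L_i$ (left ends) and $R_i,R_j,R_k$ (right ends). Network A: internal edges $e_i,e_j,e_k$; vertex $V_1$ with labels $(p,q)=(j,k)$, BL$=L_j$, TL$=L_k$, TR$=e_j$, BR$=e_k$; $V_2$ with $(i,k)$, BL$=L_i$, TL$=e_k$, TR$=e_i$, BR$=R_k$; $V_3$ with $(i,j)$, BL$=e_i$, TL$=e_j$, TR$=R_i$,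 BR$=R_j$. Network B: internal edges $f_i,f_j,f_k$; $W_1$ with $(i,j)$, BL$=L_i$, TL$=L_j$, TR$=f_i$, BR$=f_j$; $W_2$ with $(i,k)$, BL$=f_i$, TL$=L_k$, TR$=R_i$, BR$=f_k$; $W_3$ with $(j,k)$, BL$=f_j$, TL$=f_k$, TR$=R_j$, BR$=R_k$. $Z_A(\sigma)$, $Z_B(\sigma)$ denote the sums over internal edge orientations of the products of the three vertex weights. -}

module Defs where

open import Level using (Level)
open import Algebra.Bundles using (CommutativeRing)

data Dir : Set where
  left right : Dir

module GammaIce {c ℓ : Level} (R : CommutativeRing c ℓ) where
  open CommutativeRing R

  a₁ a₂ b₁ b₂ c₁ c₂ : Carrier → Carrier → Carrier → Carrier
  a₁ t zi zj = t * zi + zj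
  a₂ t zi zj = t * zj + zi
  b₁ t zi zj = t * (zj - zi)
  b₂ t zi zj = zi - zj
  c₁ t zi zj = (t + 1#) * zi
  c₂ t zi zj = (t + 1#) * zj

  -- Weight of a vertex with ascending line label p (parameter zp) and
  -- descending line label q (parameter zq), edges given as BL TL TR BR.
  weight : Carrier → Carrier → Carrier → Dir → Dir → Dir → Dir → Carrier
  weight t zp zq left  left  left  left  = a₁ t zp zq
  weight t zp zq right right right right = a₂ t zp zq
  weight t zp zq left  right left  right = b₁ t zp zq
  weight t zp zq right left  right left  = b₂ t zp zq
  weight t zp zq right left  left  right = c₁ t zp zq
  weight t zp zq left  right right left  = c₂ t zp zq
  weight t zp zq _     _     _     _     = 0#

  ΣDir : (Dir → Carrier) → Carrier
  ΣDir f = f left + f right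

  Z-A : (t zi zj zk : Carrier) (Lk Lj Li Ri Rj Rk : Dir) → Carrier
  Z-A t zi zj zk Lk Lj Li Ri Rj Rk =
    ΣDir λ ei → ΣDir λ ej → ΣDir λ ek →
      weight t zj zk Lj Lk ej ek
      * (weight t zi zk Li ek ei Rk
      * weight t zi zj ei ej Ri Rj)

  Z-B : (t zi zj zk : Carrier) (Lk Lj Li Ri Rj Rk : Dir) → Carrier
  Z-B t zi zj zk Lk Lj Li Ri Rj Rk =
    ΣDir λ fi → ΣDir λ fj → ΣDir λ fk →
      weight t zi zj Li Lj fi fj
      * (weight t zi zk fi Lk Ri fk
      * weight t zj zk fj fk Rj Rk)

{-# OPTIONS --safe #-}

-- The identity is a polynomial identity with integer coefficients for each of
-- the 64 boundary conditions.  Both partition functions are written as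
-- integer polynomials in t, zᵢ, zⱼ, z_k, whose normal forms are compared by
-- computation, and then evaluated along the unique ring homomorphism from ℤ.

module Submission where

open import Defs
open import Level using (Level)
open import Algebra.Bundles using (CommutativeRing)
open import Algebra.Solver.Ring.AlmostCommutativeRing
  using (fromCommutativeRing; _-Raw-AlmostCommutative⟶_; Induced-equivalence)
open import Data.Fin using (#_)
open import Data.Integer as ℤ using (ℤ; +_; -[1+_]; 0ℤ; 1ℤ)
import Data.Integer.Properties as ℤ
open import Data.Maybe using (Maybe; map; zipWith; from-just)
open import Data.Nat as ℕ using (zero; suc)
open import Data.Vec using (Vec; []; _∷_)
open import Relation.Binary.Definitions using (WeaklyDecidable)
open import Relation.Binary.PropositionalEquality as ≡ using (_≡_; cong; cong₂)
open import Relation.Nullary.Decidable using (dec⇒maybe)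
import Algebra.Properties.AbelianGroup
import Algebra.Properties.Ring
import Algebra.Properties.Semiring.Mult.TCOptimised
import Algebra.Solver.Ring
import Relation.Binary.Reasoning.Setoid

module IntegerCoefficients {c ℓ : Level} (R : CommutativeRing c ℓ) where
  open CommutativeRing R
  open Algebra.Properties.AbelianGroup +-abelianGroup
    using (ε⁻¹≈ε; ⁻¹-involutive; ⁻¹-∙-comm)
  open Algebra.Properties.Ring ring using (-‿distribˡ-*; -‿distribʳ-*)
  open Algebra.Properties.Semiring.Mult.TCOptimised semiring
    using (_×_; 1+×; ×-homo-+; ×1-homo-*)
  open Relation.Binary.Reasoning.Setoid setoid

  -- With this version of `_×_`, `1 × 1#` reduces to `1#` itself, not to a sum with `0#`; `1-homo`
  -- and the later evaluation of `con 1ℤ` therefore hold by reflexivity.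
  fromℤ : ℤ → Carrier
  fromℤ (+ n)    = n × 1#
  fromℤ -[1+ n ] = - (suc n × 1#)

  fromℤ-neg : ∀ i → fromℤ (ℤ.- i) ≈ - fromℤ i
  fromℤ-neg (+ zero)  = sym ε⁻¹≈ε
  fromℤ-neg (+ suc n) = refl
  fromℤ-neg -[1+ n ]  = sym (⁻¹-involutive _)

  [x+y]-[x+z]≈y-z : ∀ x y z → (x + y) - (x + z) ≈ y - z
  [x+y]-[x+z]≈y-z x y z = begin
    (x + y) - (x + z)      ≈⟨ +-cong (+-comm x y) (sym (⁻¹-∙-comm x z)) ⟩
    (y + x) + (- x - z)    ≈⟨ +-assoc y x _ ⟩
    y + (x + (- x - z))    ≈⟨ +-congˡ (+-assoc x (- x) (- z)) ⟨
    y + ((x - x) - z)      ≈⟨ +-congˡ (+-congʳ (-‿inverseʳ x)) ⟩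
    y + (0# - z)           ≈⟨ +-congˡ (+-identityˡ (- z)) ⟩
    y - z                  ∎

  -- Integer addition with opposite signs computes to `⊖`. The induction strips one successor from
  -- both arguments, which cancels a `1#` in the difference.
  fromℤ-⊖ : ∀ m n → fromℤ (m ℤ.⊖ n) ≈ m × 1# - n × 1#
  fromℤ-⊖ zero    zero    = sym (-‿inverseʳ 0#)
  fromℤ-⊖ (suc m) zero    = sym (trans (+-congˡ ε⁻¹≈ε) (+-identityʳ _))
  fromℤ-⊖ zero    (suc n) = sym (+-identityˡ _)
  fromℤ-⊖ (suc m) (suc n) = begin
    fromℤ (suc m ℤ.⊖ suc n)            ≡⟨ cong fromℤ (ℤ.[1+m]⊖[1+n]≡m⊖n m n) ⟩
    fromℤ (m ℤ.⊖ n)                    ≈⟨ fromℤ-⊖ m n ⟩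
    m × 1# - n × 1#                    ≈⟨ [x+y]-[x+z]≈y-z 1# _ _ ⟨
    (1# + m × 1#) - (1# + n × 1#)      ≈⟨ +-cong (1+× m 1#) (-‿cong (1+× n 1#)) ⟨
    suc m × 1# - suc n × 1#            ∎

  fromℤ-+ : ∀ i j → fromℤ (i ℤ.+ j) ≈ fromℤ i + fromℤ j
  fromℤ-+ (+ m)    (+ n)    = ×-homo-+ 1# m n
  fromℤ-+ (+ m)    -[1+ n ] = fromℤ-⊖ m (suc n)
  fromℤ-+ -[1+ m ] (+ n)    = trans (fromℤ-⊖ n (suc m)) (+-comm _ _)
  fromℤ-+ -[1+ m ] -[1+ n ] = begin
    -- Rewriting the sum as the negative of a sum of positives exposes the count `suc m ℕ.+ suc n`,
    -- on which `×-homo-+` acts.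
    fromℤ (-[1+ m ] ℤ.+ -[1+ n ])      ≡⟨ cong fromℤ (ℤ.neg-distrib-+ (+ suc m) (+ suc n)) ⟨
    - ((suc m ℕ.+ suc n) × 1#)         ≈⟨ -‿cong (×-homo-+ 1# (suc m) (suc n)) ⟩
    - (suc m × 1# + suc n × 1#)        ≈⟨ ⁻¹-∙-comm _ _ ⟨
    - (suc m × 1#) - suc n × 1#        ∎

  -- Signs are pulled out one factor at a time: a negative right factor reduces to the first clause
  -- here, and `fromℤ-*` treats a negative left factor in the same way.
  fromℤ-+* : ∀ m j → fromℤ (+ m ℤ.* j) ≈ m × 1# * fromℤ j
  fromℤ-+* m (+ n) = begin
    fromℤ (+ m ℤ.* + n)   ≡⟨ cong fromℤ (ℤ.pos-* m n) ⟨
    (m ℕ.* n) × 1#        ≈⟨ ×1-homo-* m n ⟩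
    m × 1# * (n × 1#)     ∎
  fromℤ-+* m -[1+ n ] = begin
    fromℤ (+ m ℤ.* -[1+ n ])          ≡⟨ cong fromℤ (ℤ.neg-distribʳ-* (+ m) (+ suc n)) ⟨
    fromℤ (ℤ.- (+ m ℤ.* + suc n))     ≈⟨ fromℤ-neg (+ m ℤ.* + suc n) ⟩
    - fromℤ (+ m ℤ.* + suc n)         ≈⟨ -‿cong (fromℤ-+* m (+ suc n)) ⟩
    - (m × 1# * (suc n × 1#))         ≈⟨ -‿distribʳ-* _ _ ⟩
    m × 1# * - (suc n × 1#)           ∎

  fromℤ-* : ∀ i j → fromℤ (i ℤ.* j) ≈ fromℤ i * fromℤ j
  fromℤ-* (+ m)    j = fromℤ-+* m j
  fromℤ-* -[1+ m ] j = begin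
    fromℤ (-[1+ m ] ℤ.* j)            ≡⟨ cong fromℤ (ℤ.neg-distribˡ-* (+ suc m) j) ⟨
    fromℤ (ℤ.- (+ suc m ℤ.* j))       ≈⟨ fromℤ-neg (+ suc m ℤ.* j) ⟩
    - fromℤ (+ suc m ℤ.* j)           ≈⟨ -‿cong (fromℤ-+* (suc m) j) ⟩
    - (suc m × 1# * fromℤ j)          ≈⟨ -‿distribˡ-* _ _ ⟩
    - (suc m × 1#) * fromℤ j          ∎

  fromℤ-morphism : ℤ.+-*-rawRing -Raw-AlmostCommutative⟶ fromCommutativeRing R
  fromℤ-morphism = record
    { ⟦_⟧    = fromℤ
    ; +-homo = fromℤ-+
    ; *-homo = fromℤ-*
    ; -‿homo = fromℤ-neg
    ; 0-homo = refl
    ; 1-homo = refl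
    }

  -- Equality in `R` need not be decidable, so coefficients are compared in ℤ; `nothing` asserts no
  -- inequality of the images.
  _≟ᶜ_ : WeaklyDecidable (Induced-equivalence fromℤ-morphism)
  i ≟ᶜ j = map (λ i≡j → reflexive (cong fromℤ i≡j)) (dec⇒maybe (i ℤ.≟ j))

  open Algebra.Solver.Ring
    ℤ.+-*-rawRing (fromCommutativeRing R) fromℤ-morphism _≟ᶜ_ public

every : ∀ {p} {P : Dir → Set p} → (∀ d → Maybe (P d)) → Maybe (∀ d → P d)
every f = zipWith (λ l r → λ { left → l ; right → r }) (f left) (f right)

module Symbolic {c ℓ : Level} (R : CommutativeRing c ℓ) where
  open CommutativeRing R using (Carrier; _+_; _*_; _≈_)
  open IntegerCoefficients R
  open GammaIce R

  Poly : Set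
  Poly = Polynomial 4

  T Zi Zj Zk : Poly
  T  = var (# 0)
  Zi = var (# 1)
  Zj = var (# 2)
  Zk = var (# 3)

  -- The clauses mirror those of `weight` term by term, so that evaluation returns the same
  -- expression and not merely an equal one.
  weightᴾ : Poly → Poly → Dir → Dir → Dir → Dir → Poly
  weightᴾ p q left  left  left  left  = T :* p :+ q
  weightᴾ p q right right right right = T :* q :+ p
  weightᴾ p q left  right left  right = T :* (q :- p)
  weightᴾ p q right left  right left  = p :- q
  weightᴾ p q right left  left  right = (T :+ con 1ℤ) :* p
  weightᴾ p q left  right right left  = (T :+ con 1ℤ) :* q
  weightᴾ p q _     _     _     _     = con 0ℤ

  ΣDirᴾ : (Dir → Poly) → Poly
  ΣDirᴾ f = f left :+ f right

  Z-Aᴾ Z-Bᴾ : (Lk Lj Li Ri Rj Rk : Dir) → Poly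
  Z-Aᴾ Lk Lj Li Ri Rj Rk =
    ΣDirᴾ λ ei → ΣDirᴾ λ ej → ΣDirᴾ λ ek →
      weightᴾ Zj Zk Lj Lk ej ek
      :* (weightᴾ Zi Zk Li ek ei Rk
      :* weightᴾ Zi Zj ei ej Ri Rj)
  Z-Bᴾ Lk Lj Li Ri Rj Rk =
    ΣDirᴾ λ fi → ΣDirᴾ λ fj → ΣDirᴾ λ fk →
      weightᴾ Zi Zj Li Lj fi fj
      :* (weightᴾ Zi Zk fi Lk Ri fk
      :* weightᴾ Zj Zk fj fk Rj Rk)

  -- The type of `from-just` reduces to the required one only if the nested search returns `just`,
  -- so type checking settles all 64 cases. The search computes with `R` abstract because the
  -- coefficients are concrete integers.
  Z-A≈Z-Bᴾ : ∀ Lk Lj Li Ri Rj Rk →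
    normalise (Z-Aᴾ Lk Lj Li Ri Rj Rk) ≈N normalise (Z-Bᴾ Lk Lj Li Ri Rj Rk)
  Z-A≈Z-Bᴾ = from-just
    (every λ Lk → every λ Lj → every λ Li → every λ Ri → every λ Rj → every λ Rk →
      normalise (Z-Aᴾ Lk Lj Li Ri Rj Rk) ≟N normalise (Z-Bᴾ Lk Lj Li Ri Rj Rk))

  ΣDir-cong : ∀ {f g : Dir → Carrier} → (∀ d → f d ≡ g d) → ΣDir f ≡ ΣDir g
  ΣDir-cong f≡g = cong₂ _+_ (f≡g left) (f≡g right)

  module _ (t zi zj zk : Carrier) where

    ρ : Vec Carrier 4
    ρ = t ∷ zi ∷ zj ∷ zk ∷ []

    -- Both sides reduce only once the orientations are known, hence the split into 16 cases.
    ⟦weight⟧ : ∀ p q BL TL TR BR →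
      ⟦ weightᴾ p q BL TL TR BR ⟧ ρ ≡ weight t (⟦ p ⟧ ρ) (⟦ q ⟧ ρ) BL TL TR BR
    ⟦weight⟧ p q left  left  left  left  = ≡.refl
    ⟦weight⟧ p q left  left  left  right = ≡.refl
    ⟦weight⟧ p q left  left  right left  = ≡.refl
    ⟦weight⟧ p q left  left  right right = ≡.refl
    ⟦weight⟧ p q left  right left  left  = ≡.refl
    ⟦weight⟧ p q left  right left  right = ≡.refl
    ⟦weight⟧ p q left  right right left  = ≡.refl
    ⟦weight⟧ p q left  right right right = ≡.refl
    ⟦weight⟧ p q right left  left  left  = ≡.refl
    ⟦weight⟧ p q right left  left  right = ≡.refl
    ⟦weight⟧ p q right left  right left  = ≡.refl
    ⟦weight⟧ p q right left  right right = ≡.refl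
    ⟦weight⟧ p q right right left  left  = ≡.refl
    ⟦weight⟧ p q right right left  right = ≡.refl
    ⟦weight⟧ p q right right right left  = ≡.refl
    ⟦weight⟧ p q right right right right = ≡.refl

    ⟦Z-A⟧ : ∀ Lk Lj Li Ri Rj Rk →
      ⟦ Z-Aᴾ Lk Lj Li Ri Rj Rk ⟧ ρ ≡ Z-A t zi zj zk Lk Lj Li Ri Rj Rk
    ⟦Z-A⟧ Lk Lj Li Ri Rj Rk = ΣDir-cong λ ei → ΣDir-cong λ ej → ΣDir-cong λ ek →
      cong₂ _*_ (⟦weight⟧ Zj Zk Lj Lk ej ek)
        (cong₂ _*_ (⟦weight⟧ Zi Zk Li ek ei Rk) (⟦weight⟧ Zi Zj ei ej Ri Rj))

    ⟦Z-B⟧ : ∀ Lk Lj Li Ri Rj Rk →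
      ⟦ Z-Bᴾ Lk Lj Li Ri Rj Rk ⟧ ρ ≡ Z-B t zi zj zk Lk Lj Li Ri Rj Rk
    ⟦Z-B⟧ Lk Lj Li Ri Rj Rk = ΣDir-cong λ fi → ΣDir-cong λ fj → ΣDir-cong λ fk →
      cong₂ _*_ (⟦weight⟧ Zi Zj Li Lj fi fj)
        (cong₂ _*_ (⟦weight⟧ Zi Zk fi Lk Ri fk) (⟦weight⟧ Zj Zk fj fk Rj Rk))

theorem3p1 : {c ℓ : Level} (R : CommutativeRing c ℓ) →
    (t zi zj zk : CommutativeRing.Carrier R) (Lk Lj Li Ri Rj Rk : Dir) →
    CommutativeRing._≈_ R
    (GammaIce.Z-A R t zi zj zk Lk Lj Li Ri Rj Rk)
    (GammaIce.Z-B R t zi zj zk Lk Lj Li Ri Rj Rk)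
theorem3p1 R t zi zj zk Lk Lj Li Ri Rj Rk = begin
  Z-A t zi zj zk Lk Lj Li Ri Rj Rk     ≡⟨ ⟦Z-A⟧ t zi zj zk Lk Lj Li Ri Rj Rk ⟨
  -- For variable orientations the normal forms do not compute, so their equality is read off from
  -- `Z-A≈Z-Bᴾ` and then evaluated at `σ`.
  ⟦ Z-Aᴾ Lk Lj Li Ri Rj Rk ⟧ σ         ≈⟨ prove σ (Z-Aᴾ Lk Lj Li Ri Rj Rk) (Z-Bᴾ Lk Lj Li Ri Rj Rk)
                                            (⟦ Z-A≈Z-Bᴾ Lk Lj Li Ri Rj Rk ⟧N-cong σ) ⟩
  ⟦ Z-Bᴾ Lk Lj Li Ri Rj Rk ⟧ σ         ≡⟨ ⟦Z-B⟧ t zi zj zk Lk Lj Li Ri Rj Rk ⟩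
  Z-B t zi zj zk Lk Lj Li Ri Rj Rk     ∎
  where
  open CommutativeRing R using (setoid)
  open Relation.Binary.Reasoning.Setoid setoid
  open GammaIce R
  open IntegerCoefficients R
  open Symbolic R
  σ = ρ t zi zj zk
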